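{- Let $G$ be an ordered abelian group which is not divisible. Then the Grothendieck ring of definable sets of $G$ is trivial: $\mathrm{K}\,G = 0$.
   Context: An ordered abelian group is an abelian group $G$ with a translation-invariant total order; it is regarded as a first-order structure in the language $\mathcal{L}_{\mathrm{oag}} = \{0,+,-,<\}$. "Definable in $G$" means $\mathcal{L}_{\mathrm{oag}}(G)$-definable, i.e. first-order definable with parameters from $G$. Write $\mathrm{Def}(G)$ for the collection of all definable subsets of $G^n$, for $n \in \mathbb{N}$. A map between definable sets is definable if its graph is a definable set. The (model-theoretic) Grothendieck ring $\mathrm{K}\,G$ is the following ring. Its underlying abelian group has generators $[A]$ for all $A \in \mathrm{Def}(G)$, subject to the relations: (i) $[A] = [B]$ whenever there exists a definable bijection $A \to B$ (where $A$ and $B$ may lie in different powers of $G$); (ii) $[A \setminus B] + [B] = [A]$ for all $A, B \in \mathrm{Def}(G)$ with $B \subseteq A$. Multiplication is induced by the cartesian product: $[A]\cdot[B] = [A \times B]$. The zero element is $[\emptyset]$ and the unit is $1 = [\{a\}]$ for any $a \in G$. $G$ is $n$-divisible, for an integer $n\ge 1$, if for every $g \in G$ there is $h \in G$ with $nh = g$; $G$ is divisible if it is $n$-divisible for every integer $n \geq 1$. -}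

module Defs where

open import Algebra.Bundles using (AbelianGroup; CommutativeRing)
open import Algebra.Structures using (IsAbelianGroup)
import Algebra.Definitions.RawMonoid as RawMonoidDefs
import Algebra.Properties.AbelianGroup as AbelianGroupProperties
open import Data.Empty.Polymorphic using (⊥)
open import Data.Fin.Base using (Fin; zero; suc; _↑ˡ_; _↑ʳ_; splitAt)
open import Data.Nat.Base as ℕ using (ℕ; zero; suc; NonZero)
open import Data.Product.Base using (Σ; ∃; Σ-syntax; ∃-syntax; _×_; _,_; proj₁; proj₂)
open import Data.Sum.Base as Sum using (_⊎_; inj₁; inj₂)
open import Data.Vec.Functional as Vector using (Vector; _∷_; _++_)
import Data.Vec.Functional.Relation.Binary.Equality.Setoid as VectorEquality
open import Data.Vec.Functional.Properties using (lookup-++ˡ; lookup-++ʳ)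
open import Data.Fin.Properties using (join-splitAt)
open import Function.Base using (_∘_; id)
open import Function.Bundles using (Bijection; _⇔_; mk⇔; Equivalence)
open import Level using (Level; _⊔_; Lift; lift; lower) renaming (suc to lsuc)
open import Relation.Binary.Bundles using (Setoid)
open import Relation.Binary.Core using (Rel)
open import Relation.Binary.Structures using (IsStrictTotalOrder)
import Relation.Binary.Reasoning.Setoid as SetoidReasoning
open import Relation.Binary.PropositionalEquality.Core as ≡ using (_≡_)

record OrderedAbelianGroup c ℓ₁ ℓ₂ : Set (lsuc (c ⊔ ℓ₁ ⊔ ℓ₂)) where
  infix  8 -_
  infixl 6 _+_
  infix  4 _≈_ _<_
  field
    Carrier            : Set c
    _≈_                : Rel Carrier ℓ₁
    _<_                : Rel Carrier ℓ₂
    _+_                : Carrier → Carrier → Carrier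
    0#                 : Carrier
    -_                 : Carrier → Carrier
    isAbelianGroup     : IsAbelianGroup _≈_ _+_ 0# -_
    isStrictTotalOrder : IsStrictTotalOrder _≈_ _<_
    +-monoˡ-<          : ∀ z {x y} → x < y → x + z < y + z

  abelianGroup : AbelianGroup c ℓ₁
  abelianGroup = record { isAbelianGroup = isAbelianGroup }

  open AbelianGroup abelianGroup public using (setoid; rawMonoid)

module _ {c ℓ₁ ℓ₂} (G : OrderedAbelianGroup c ℓ₁ ℓ₂) where
  open OrderedAbelianGroup G
  open RawMonoidDefs rawMonoid using () renaming (_×_ to _·_)

  _-Divisible : ℕ → Set (c ⊔ ℓ₁)
  n -Divisible = ∀ g → ∃[ h ] n · h ≈ g

  Divisible : Set (c ⊔ ℓ₁)
  Divisible = ∀ n → .{{NonZero n}} → n -Divisible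

-- Variables are de Bruijn indices; `par` embeds the parameters.

infix  9 -ᵗ_
infixl 8 _+ᵗ_
infix  7 _≈ᶠ_ _<ᶠ_
infixr 6 _∧ᶠ_
infixr 5 _∨ᶠ_
infixr 4 _⇒ᶠ_

data Term {c} (C : Set c) (n : ℕ) : Set c where
  var  : Fin n → Term C n
  par  : C → Term C n
  0ᵗ   : Term C n
  _+ᵗ_ : Term C n → Term C n → Term C n
  -ᵗ_  : Term C n → Term C n

data Formula {c} (C : Set c) (n : ℕ) : Set c where
  _≈ᶠ_ _<ᶠ_      : Term C n → Term C n → Formula C n
  ⊥ᶠ             : Formula C n
  _∧ᶠ_ _∨ᶠ_ _⇒ᶠ_ : Formula C n → Formula C n → Formula C n
  ∀ᶠ ∃ᶠ          : Formula C (suc n) → Formula C n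

module _ {c} {C : Set c} where

  ¬ᶠ_ : ∀ {n} → Formula C n → Formula C n
  ¬ᶠ φ = φ ⇒ᶠ ⊥ᶠ

  ⊤ᶠ : ∀ {n} → Formula C n
  ⊤ᶠ = ¬ᶠ ⊥ᶠ

  ⋀ᶠ : ∀ {k n} → (Fin k → Formula C n) → Formula C n
  ⋀ᶠ = Vector.foldr _∧ᶠ_ ⊤ᶠ

  renameᵗ : ∀ {m n} → (Fin m → Fin n) → Term C m → Term C n
  renameᵗ ρ (var i)  = var (ρ i)
  renameᵗ ρ (par a)  = par a
  renameᵗ ρ 0ᵗ       = 0ᵗ
  renameᵗ ρ (s +ᵗ t) = renameᵗ ρ s +ᵗ renameᵗ ρ t
  renameᵗ ρ (-ᵗ t)   = -ᵗ renameᵗ ρ t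

  rename : ∀ {m n} → (Fin m → Fin n) → Formula C m → Formula C n
  rename ρ (s ≈ᶠ t) = renameᵗ ρ s ≈ᶠ renameᵗ ρ t
  rename ρ (s <ᶠ t) = renameᵗ ρ s <ᶠ renameᵗ ρ t
  rename ρ ⊥ᶠ       = ⊥ᶠ
  rename ρ (φ ∧ᶠ ψ) = rename ρ φ ∧ᶠ rename ρ ψ
  rename ρ (φ ∨ᶠ ψ) = rename ρ φ ∨ᶠ rename ρ ψ
  rename ρ (φ ⇒ᶠ ψ) = rename ρ φ ⇒ᶠ rename ρ ψ
  rename ρ (∀ᶠ φ)   = ∀ᶠ (rename (zero ∷ (suc ∘ ρ)) φ)
  rename ρ (∃ᶠ φ)   = ∃ᶠ (rename (zero ∷ (suc ∘ ρ)) φ)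

module Definability {c ℓ₁ ℓ₂} (G : OrderedAbelianGroup c ℓ₁ ℓ₂) where
  open OrderedAbelianGroup G
  open Setoid setoid using (refl; sym; trans; reflexive)
  open VectorEquality setoid public using (_≋_)

  private
    ℓ : Level
    ℓ = c ⊔ ℓ₁ ⊔ ℓ₂

  eval : ∀ {n} → Term Carrier n → Vector Carrier n → Carrier
  eval (var i)  v = v i
  eval (par a)  v = a
  eval 0ᵗ       v = 0#
  eval (s +ᵗ t) v = eval s v + eval t v
  eval (-ᵗ t)   v = - eval t v

  -- The connectives are read intuitionistically, so this is the usual
  -- Tarskian satisfaction relation only in the presence of excluded middle.
  Sat : ∀ {n} → Formula Carrier n → Vector Carrier n → Set ℓ
  Sat (s ≈ᶠ t) v = Lift ℓ (eval s v ≈ eval t v)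
  Sat (s <ᶠ t) v = Lift ℓ (eval s v < eval t v)
  Sat ⊥ᶠ       v = ⊥
  Sat (φ ∧ᶠ ψ) v = Sat φ v × Sat ψ v
  Sat (φ ∨ᶠ ψ) v = Sat φ v ⊎ Sat ψ v
  Sat (φ ⇒ᶠ ψ) v = Sat φ v → Sat ψ v
  Sat (∀ᶠ φ)   v = ∀ a → Sat φ (a ∷ v)
  Sat (∃ᶠ φ)   v = ∃[ a ] Sat φ (a ∷ v)

  -- A definable subset of Gⁿ is given by a formula defining it; formulas
  -- with the same extension are identified in the Grothendieck ring,
  -- the identity map being a definable bijection.
  Def : ℕ → Set c
  Def n = Formula Carrier n

  infix 4 _⊆_
  _⊆_ : ∀ {n} → Def n → Def n → Set ℓ
  A ⊆ B = ∀ x → Sat A x → Sat B x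

  ∅ : ∀ {n} → Def n
  ∅ = ⊥ᶠ

  singleton : Carrier → Def 1
  singleton a = var zero ≈ᶠ par a

  infixl 6 _∖_
  _∖_ : ∀ {n} → Def n → Def n → Def n
  A ∖ B = A ∧ᶠ ¬ᶠ B

  infixr 7 _⊗_
  _⊗_ : ∀ {m n} → Def m → Def n → Def (m ℕ.+ n)
  _⊗_ {m} {n} A B = rename (_↑ˡ n) A ∧ᶠ rename (m ↑ʳ_) B

  ⟦_⟧ : ∀ {n} → Def n → Setoid ℓ ℓ₁
  ⟦_⟧ {n} A = record
    { Carrier       = Σ (Vector Carrier n) (Sat A)
    ; _≈_           = λ x y → proj₁ x ≋ proj₁ y
    ; isEquivalence = record
      { refl  = λ _ → refl
      ; sym   = λ p i → sym (p i)
      ; trans = λ p q i → trans (p i) (q i)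
      }
    }

  record DefinableBijection {m n} (A : Def m) (B : Def n) : Set ℓ where
    field
      bijection : Bijection ⟦ A ⟧ ⟦ B ⟧

    open Bijection bijection public

    field
      graph     : Def (m ℕ.+ n)
      graph-def : ∀ x y → Sat graph (x ++ y) ⇔ (Σ[ p ∈ Sat A x ] proj₁ (to (x , p)) ≋ y)

  private
    ≡⇒≈ : ∀ {x y} → x ≡ y → x ≈ y
    ≡⇒≈ = reflexive

    open AbelianGroup abelianGroup using (∙-cong; ⁻¹-cong)
    open IsStrictTotalOrder isStrictTotalOrder using (<-resp-≈)

    <-cong : ∀ {a b a′ b′} → a ≈ a′ → b ≈ b′ → a < b → a′ < b′
    <-cong p q r = proj₂ <-resp-≈ p (proj₁ <-resp-≈ q r)

  eval-rename : ∀ {m n} (t : Term Carrier m) (ρ : Fin m → Fin n) {v w} →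
                v ∘ ρ ≋ w → eval (renameᵗ ρ t) v ≈ eval t w
  eval-rename (var i)  ρ p = p i
  eval-rename (par a)  ρ p = refl
  eval-rename 0ᵗ       ρ p = refl
  eval-rename (s +ᵗ t) ρ p = ∙-cong (eval-rename s ρ p) (eval-rename t ρ p)
  eval-rename (-ᵗ t)   ρ p = ⁻¹-cong (eval-rename t ρ p)

  private
    ∷-lift : ∀ {m n} (ρ : Fin m → Fin n) {v w} a → v ∘ ρ ≋ w →
             (a ∷ v) ∘ (zero ∷ (suc ∘ ρ)) ≋ a ∷ w
    ∷-lift ρ a p zero    = refl
    ∷-lift ρ a p (suc i) = p i

  mutual
    rename⁻ : ∀ {m n} (φ : Def m) (ρ : Fin m → Fin n) {v w} →
              v ∘ ρ ≋ w → Sat (rename ρ φ) v → Sat φ w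
    rename⁻ (s ≈ᶠ t) ρ p (lift q) =
      lift (trans (sym (eval-rename s ρ p)) (trans q (eval-rename t ρ p)))
    rename⁻ (s <ᶠ t) ρ p (lift q) =
      lift (<-cong (eval-rename s ρ p) (eval-rename t ρ p) q)
    rename⁻ (φ ∧ᶠ ψ) ρ p (x , y)  = rename⁻ φ ρ p x , rename⁻ ψ ρ p y
    rename⁻ (φ ∨ᶠ ψ) ρ p (inj₁ x) = inj₁ (rename⁻ φ ρ p x)
    rename⁻ (φ ∨ᶠ ψ) ρ p (inj₂ y) = inj₂ (rename⁻ ψ ρ p y)
    rename⁻ (φ ⇒ᶠ ψ) ρ p f x      = rename⁻ ψ ρ p (f (rename⁺ φ ρ p x))
    rename⁻ (∀ᶠ φ)   ρ p f a      = rename⁻ φ _ (∷-lift ρ a p) (f a)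
    rename⁻ (∃ᶠ φ)   ρ p (a , x)  = a , rename⁻ φ _ (∷-lift ρ a p) x

    rename⁺ : ∀ {m n} (φ : Def m) (ρ : Fin m → Fin n) {v w} →
              v ∘ ρ ≋ w → Sat φ w → Sat (rename ρ φ) v
    rename⁺ (s ≈ᶠ t) ρ p (lift q) =
      lift (trans (eval-rename s ρ p) (trans q (sym (eval-rename t ρ p))))
    rename⁺ (s <ᶠ t) ρ p (lift q) =
      lift (<-cong (sym (eval-rename s ρ p)) (sym (eval-rename t ρ p)) q)
    rename⁺ (φ ∧ᶠ ψ) ρ p (x , y)  = rename⁺ φ ρ p x , rename⁺ ψ ρ p y
    rename⁺ (φ ∨ᶠ ψ) ρ p (inj₁ x) = inj₁ (rename⁺ φ ρ p x)
    rename⁺ (φ ∨ᶠ ψ) ρ p (inj₂ y) = inj₂ (rename⁺ ψ ρ p y)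
    rename⁺ (φ ⇒ᶠ ψ) ρ p f x      = rename⁺ ψ ρ p (f (rename⁻ φ ρ p x))
    rename⁺ (∀ᶠ φ)   ρ p f a      = rename⁺ φ _ (∷-lift ρ a p) (f a)
    rename⁺ (∃ᶠ φ)   ρ p (a , x)  = a , rename⁺ φ _ (∷-lift ρ a p) x

  Sat-cong : ∀ {n} (φ : Def n) {v w} → v ≋ w → Sat φ v → Sat φ w
  Sat-cong φ {v} p x = rename⁻ φ id p (rename⁺ φ id {v} (λ _ → refl) x)

  ⋀⁺ : ∀ {k n} (φ : Fin k → Def n) {v} → (∀ i → Sat (φ i) v) → Sat (⋀ᶠ φ) v
  ⋀⁺ {zero}  φ f = λ x → x
  ⋀⁺ {suc k} φ f = f zero , ⋀⁺ (φ ∘ suc) (f ∘ suc)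

  ⋀⁻ : ∀ {k n} (φ : Fin k → Def n) {v} → Sat (⋀ᶠ φ) v → ∀ i → Sat (φ i) v
  ⋀⁻ φ (x , y) zero    = x
  ⋀⁻ φ (x , y) (suc i) = ⋀⁻ (φ ∘ suc) y i

  module _ {m n} (x : Vector Carrier m) (y : Vector Carrier n) where
    take-++ : (x ++ y) ∘ (_↑ˡ n) ≋ x
    take-++ i = ≡⇒≈ (lookup-++ˡ x y i)

    drop-++ : (x ++ y) ∘ (m ↑ʳ_) ≋ y
    drop-++ i = ≡⇒≈ (lookup-++ʳ x y i)

  ≋-split : ∀ m {n} {x y : Vector Carrier (m ℕ.+ n)} →
            x ∘ (_↑ˡ n) ≋ y ∘ (_↑ˡ n) → x ∘ (m ↑ʳ_) ≋ y ∘ (m ↑ʳ_) → x ≋ y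
  ≋-split m {n} p q i with splitAt m i | join-splitAt m n i
  ... | inj₁ j | ≡.refl = p j
  ... | inj₂ j | ≡.refl = q j

  module _ {m n} (A : Def m) (B : Def n) where
    ⊗⁺ : ∀ {v} → Sat A (v ∘ (_↑ˡ n)) → Sat B (v ∘ (m ↑ʳ_)) → Sat (A ⊗ B) v
    ⊗⁺ p q = rename⁺ A _ (λ _ → refl) p , rename⁺ B _ (λ _ → refl) q

    ⊗⁻ˡ : ∀ {v} → Sat (A ⊗ B) v → Sat A (v ∘ (_↑ˡ n))
    ⊗⁻ˡ (p , _) = rename⁻ A _ (λ _ → refl) p

    ⊗⁻ʳ : ∀ {v} → Sat (A ⊗ B) v → Sat B (v ∘ (m ↑ʳ_))
    ⊗⁻ʳ (_ , q) = rename⁻ B _ (λ _ → refl) q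

  reindexing : ∀ {m n} (A : Def m) (B : Def n) (ρ : Fin n → Fin m) →
               (∀ x → Sat A x → Sat B (x ∘ ρ)) →
               (∀ x y → Sat A x → Sat A y → x ∘ ρ ≋ y ∘ ρ → x ≋ y) →
               (∀ y → Sat B y → ∃[ x ] Sat A x × x ∘ ρ ≋ y) →
               DefinableBijection A B
  reindexing {m} {n} A B ρ maps inj surj = record
    { bijection = record
      { to        = λ (x , p) → x ∘ ρ , maps x p
      ; cong      = λ p i → p (ρ i)
      ; bijective = (λ {(x , p)} {(y , q)} → inj x y p q)
                  , (λ (y , q) → let (x , p , e) = surj y q in
                       (x , p) , λ z≈x i → trans (z≈x (ρ i)) (e i))
      }
    ; graph     = rename (_↑ˡ n) A ∧ᶠ ⋀ᶠ eqs
    ; graph-def = λ x y → mk⇔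
        (λ (p , q) → rename⁻ A _ (take-++ x y) p , λ j →
           trans (sym (take-++ x y (ρ j)))
                 (trans (sym (lower (⋀⁻ eqs q j))) (drop-++ x y j)))
        (λ (p , q) → rename⁺ A _ (take-++ x y) p , ⋀⁺ eqs (λ j → lift
           (trans (drop-++ x y j) (trans (sym (q j)) (sym (take-++ x y (ρ j)))))))
    }
    where
    eqs : Fin n → Def (m ℕ.+ n)
    eqs j = var (m ↑ʳ j) ≈ᶠ var (ρ j ↑ˡ n)

  same-extension : ∀ {n} (A B : Def n) → A ⊆ B → B ⊆ A → DefinableBijection A B
  same-extension A B A⊆B B⊆A = reindexing A B id A⊆B (λ _ _ _ _ p → p)
    (λ y q → y , B⊆A y q , λ _ → refl)

  ⊗-comm : ∀ {m n} (A : Def m) (B : Def n) → DefinableBijection (A ⊗ B) (B ⊗ A)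
  ⊗-comm {m} {n} A B = reindexing (A ⊗ B) (B ⊗ A) (swap m n)
    (λ x p → swapped A B x p)
    (λ x y _ _ e → ≋-split m
      (λ i → trans (sym (swap-ʳ m n x i)) (trans (e (n ↑ʳ i)) (swap-ʳ m n y i)))
      (λ i → trans (sym (swap-ˡ m n x i)) (trans (e (i ↑ˡ m)) (swap-ˡ m n y i))))
    (λ y q → y ∘ swap n m , swapped B A y q , ≋-split n
      (λ i → trans (swap-ˡ m n (y ∘ swap n m) i) (swap-ʳ n m y i))
      (λ i → trans (swap-ʳ m n (y ∘ swap n m) i) (swap-ˡ n m y i)))
    where
    swap : ∀ k l → Fin (l ℕ.+ k) → Fin (k ℕ.+ l)
    swap k l = (k ↑ʳ_) ++ (_↑ˡ l)

    swap-ˡ : ∀ k l (v : Vector Carrier (k ℕ.+ l)) → v ∘ swap k l ∘ (_↑ˡ k) ≋ v ∘ (k ↑ʳ_)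
    swap-ˡ k l v i = ≡⇒≈ (≡.cong v (lookup-++ˡ (k ↑ʳ_) (_↑ˡ l) i))

    swap-ʳ : ∀ k l (v : Vector Carrier (k ℕ.+ l)) → v ∘ swap k l ∘ (l ↑ʳ_) ≋ v ∘ (_↑ˡ l)
    swap-ʳ k l v i = ≡⇒≈ (≡.cong v (lookup-++ʳ (k ↑ʳ_) (_↑ˡ l) i))

    swapped : ∀ {k l} (A : Def k) (B : Def l) x → Sat (A ⊗ B) x → Sat (B ⊗ A) (x ∘ swap k l)
    swapped {k} {l} A B x p = ⊗⁺ B A
      (Sat-cong B (λ i → sym (swap-ˡ k l x i)) (⊗⁻ʳ A B p))
      (Sat-cong A (λ i → sym (swap-ʳ k l x i)) (⊗⁻ˡ A B p))

  ⊗-assoc : ∀ {l m n} (A : Def l) (B : Def m) (C : Def n) →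
            DefinableBijection ((A ⊗ B) ⊗ C) (A ⊗ (B ⊗ C))
  ⊗-assoc {l} {m} {n} A B C = reindexing ((A ⊗ B) ⊗ C) (A ⊗ (B ⊗ C)) ρ
    (λ x p → ⊗⁺ A (B ⊗ C)
      (Sat-cong A (λ i → sym (ρ₁ x i)) (⊗⁻ˡ A B (⊗⁻ˡ (A ⊗ B) C p)))
      (⊗⁺ B C
        (Sat-cong B (λ i → sym (ρ₂ x i)) (⊗⁻ʳ A B (⊗⁻ˡ (A ⊗ B) C p)))
        (Sat-cong C (λ i → sym (ρ₃ x i)) (⊗⁻ʳ (A ⊗ B) C p))))
    (λ x y _ _ e → ≋-split (l ℕ.+ m)
      (≋-split l
        (λ i → trans (sym (ρ₁ x i)) (trans (e _) (ρ₁ y i)))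
        (λ i → trans (sym (ρ₂ x i)) (trans (e _) (ρ₂ y i))))
      (λ i → trans (sym (ρ₃ x i)) (trans (e _) (ρ₃ y i))))
    (λ y q → let
        y₁ = y ∘ (_↑ˡ (m ℕ.+ n))
        y₂ = y ∘ (l ↑ʳ_) ∘ (_↑ˡ n)
        y₃ = y ∘ (l ↑ʳ_) ∘ (m ↑ʳ_)
        x  = (y₁ ++ y₂) ++ y₃
        e₁ : x ∘ (_↑ˡ n) ∘ (_↑ˡ m) ≋ y₁
        e₁ i = trans (take-++ (y₁ ++ y₂) y₃ (i ↑ˡ m)) (take-++ y₁ y₂ i)
        e₂ : x ∘ (_↑ˡ n) ∘ (l ↑ʳ_) ≋ y₂
        e₂ i = trans (take-++ (y₁ ++ y₂) y₃ (l ↑ʳ i)) (drop-++ y₁ y₂ i)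
        e₃ : x ∘ ((l ℕ.+ m) ↑ʳ_) ≋ y₃
        e₃ = drop-++ (y₁ ++ y₂) y₃
        q′ = ⊗⁻ʳ A (B ⊗ C) q
      in x
       , ⊗⁺ (A ⊗ B) C
           (⊗⁺ A B
             (Sat-cong A (λ i → sym (e₁ i)) (⊗⁻ˡ A (B ⊗ C) q))
             (Sat-cong B (λ i → sym (e₂ i)) (⊗⁻ˡ B C q′)))
           (Sat-cong C (λ i → sym (e₃ i)) (⊗⁻ʳ B C q′))
       , ≋-split l
           (λ i → trans (ρ₁ x i) (e₁ i))
           (≋-split m (λ i → trans (ρ₂ x i) (e₂ i)) (λ i → trans (ρ₃ x i) (e₃ i))))
    where
    α : Fin l → Fin ((l ℕ.+ m) ℕ.+ n)
    α i = (i ↑ˡ m) ↑ˡ n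

    β : Fin m → Fin ((l ℕ.+ m) ℕ.+ n)
    β i = (l ↑ʳ i) ↑ˡ n

    γ : Fin n → Fin ((l ℕ.+ m) ℕ.+ n)
    γ i = (l ℕ.+ m) ↑ʳ i

    ρ : Fin (l ℕ.+ (m ℕ.+ n)) → Fin ((l ℕ.+ m) ℕ.+ n)
    ρ = α ++ (β ++ γ)

    module _ (v : Vector Carrier ((l ℕ.+ m) ℕ.+ n)) where
      ρ₁ : v ∘ ρ ∘ (_↑ˡ (m ℕ.+ n)) ≋ v ∘ α
      ρ₁ i = ≡⇒≈ (≡.cong v (lookup-++ˡ α (β ++ γ) i))

      ρ₂ : v ∘ ρ ∘ (l ↑ʳ_) ∘ (_↑ˡ n) ≋ v ∘ β
      ρ₂ i = ≡⇒≈ (≡.cong v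
        (≡.trans (lookup-++ʳ α (β ++ γ) (i ↑ˡ n)) (lookup-++ˡ β γ i)))

      ρ₃ : v ∘ ρ ∘ (l ↑ʳ_) ∘ (m ↑ʳ_) ≋ v ∘ γ
      ρ₃ i = ≡⇒≈ (≡.cong v
        (≡.trans (lookup-++ʳ α (β ++ γ) (m ↑ʳ i)) (lookup-++ʳ β γ i)))

  ⊗-identityˡ : ∀ {n} a (A : Def n) → DefinableBijection (singleton a ⊗ A) A
  ⊗-identityˡ a A = reindexing (singleton a ⊗ A) A suc
    (λ x p → ⊗⁻ʳ (singleton a) A p)
    (λ x y (p , _) (q , _) e → λ where
      zero    → trans (lower p) (sym (lower q))
      (suc i) → e i)
    (λ y q → a ∷ y , ⊗⁺ (singleton a) A (lift refl) q , λ _ → refl)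

  ⊗-congʳ : ∀ {k m n} (C : Def k) {A : Def m} {B : Def n} →
            DefinableBijection A B → DefinableBijection (C ⊗ A) (C ⊗ B)
  ⊗-congʳ {k} {m} {n} C {A} {B} f = record
    { bijection = record
      { to        = λ (v , p) → g v p , g-sat v p
      ; cong      = λ {(v , p)} {(w , q)} e → ≋-split k
          (λ i → trans (g-take v p i) (trans (e (i ↑ˡ m)) (sym (g-take w q i))))
          (λ i → trans (g-drop v p i)
                   (trans (f.cong (e ∘ (k ↑ʳ_)) i) (sym (g-drop w q i))))
      ; bijective =
          (λ {(v , p)} {(w , q)} e → ≋-split k
            (λ i → trans (sym (g-take v p i)) (trans (e (i ↑ˡ n)) (g-take w q i)))
            (f.injective λ i →
              trans (sym (g-drop v p i)) (trans (e (k ↑ʳ i)) (g-drop w q i))))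
        , (λ (y , q) → let
              y₁ = y ∘ (_↑ˡ n)
              ((x , p) , x↦y) = f.surjective (y ∘ (k ↑ʳ_) , ⊗⁻ʳ C B q)
            in ( y₁ ++ x
               , ⊗⁺ C A
                   (Sat-cong C (λ i → sym (take-++ y₁ x i)) (⊗⁻ˡ C B q))
                   (Sat-cong A (λ i → sym (drop-++ y₁ x i)) p))
             , λ {(z , r)} e → ≋-split k
                 (λ i → trans (g-take z r i) (trans (e (i ↑ˡ m)) (take-++ y₁ x i)))
                 (λ i → trans (g-drop z r i)
                   (x↦y {z ∘ (k ↑ʳ_) , ⊗⁻ʳ C A r}
                     (λ j → trans (e (k ↑ʳ j)) (drop-++ y₁ x j)) i)))
      }
    ; graph     = rename (λ i → (i ↑ˡ m) ↑ˡ (k ℕ.+ n)) C ∧ᶠ rename σ f.graph ∧ᶠ ⋀ᶠ eqs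
    ; graph-def = λ x y → mk⇔
        (λ (r , s , t) → let
            (p , e) = Equivalence.to (f.graph-def (x ∘ (k ↑ʳ_)) (y ∘ (k ↑ʳ_)))
                        (rename⁻ f.graph σ (σ-++ x y) s)
            r′ = rename⁻ C _ (λ i → take-++ x y (i ↑ˡ m)) r
            q = ⊗⁺ C A r′ p
          in q , ≋-split k
              (λ i → trans (g-take x q i)
                (trans (sym (take-++ x y (i ↑ˡ m)))
                  (trans (sym (lower (⋀⁻ eqs t i))) (drop-++ x y (i ↑ˡ n)))))
              (λ i → trans (g-drop x q i) (trans (f.cong (λ _ → refl) i) (e i))))
        (λ (q , e) →
            rename⁺ C _ (λ i → take-++ x y (i ↑ˡ m)) (⊗⁻ˡ C A q)
          , rename⁺ f.graph σ (σ-++ x y)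
              (Equivalence.from (f.graph-def (x ∘ (k ↑ʳ_)) (y ∘ (k ↑ʳ_)))
                (⊗⁻ʳ C A q , λ i → trans (sym (g-drop x q i)) (e (k ↑ʳ i))))
          , ⋀⁺ eqs (λ i → lift (trans (drop-++ x y (i ↑ˡ n))
              (trans (sym (e (i ↑ˡ n)))
                (trans (g-take x q i) (sym (take-++ x y (i ↑ˡ m))))))))
    }
    where
    module f = DefinableBijection f

    g₂ : ∀ v → Sat (C ⊗ A) v → Vector Carrier n
    g₂ v p = proj₁ (f.to (v ∘ (k ↑ʳ_) , ⊗⁻ʳ C A p))

    g : ∀ v → Sat (C ⊗ A) v → Vector Carrier (k ℕ.+ n)
    g v p = (v ∘ (_↑ˡ m)) ++ g₂ v p

    g-take : ∀ v p → g v p ∘ (_↑ˡ n) ≋ v ∘ (_↑ˡ m)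
    g-take v p = take-++ (v ∘ (_↑ˡ m)) (g₂ v p)

    g-drop : ∀ v p → g v p ∘ (k ↑ʳ_) ≋ g₂ v p
    g-drop v p = drop-++ (v ∘ (_↑ˡ m)) (g₂ v p)

    g-sat : ∀ v p → Sat (C ⊗ B) (g v p)
    g-sat v p = ⊗⁺ C B
      (Sat-cong C (λ i → sym (g-take v p i)) (⊗⁻ˡ C A p))
      (Sat-cong B (λ i → sym (g-drop v p i)) (proj₂ (f.to (v ∘ (k ↑ʳ_) , ⊗⁻ʳ C A p))))

    σ₁ : Fin m → Fin ((k ℕ.+ m) ℕ.+ (k ℕ.+ n))
    σ₁ i = (k ↑ʳ i) ↑ˡ (k ℕ.+ n)

    σ₂ : Fin n → Fin ((k ℕ.+ m) ℕ.+ (k ℕ.+ n))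
    σ₂ j = (k ℕ.+ m) ↑ʳ (k ↑ʳ j)

    σ : Fin (m ℕ.+ n) → Fin ((k ℕ.+ m) ℕ.+ (k ℕ.+ n))
    σ = σ₁ ++ σ₂

    σ-++ : ∀ x y → (x ++ y) ∘ σ ≋ (x ∘ (k ↑ʳ_)) ++ (y ∘ (k ↑ʳ_))
    σ-++ x y = ≋-split m
      (λ i → trans (≡⇒≈ (≡.cong (x ++ y) (lookup-++ˡ σ₁ σ₂ i)))
        (trans (take-++ x y (k ↑ʳ i)) (sym (take-++ (x ∘ (k ↑ʳ_)) (y ∘ (k ↑ʳ_)) i))))
      (λ i → trans (≡⇒≈ (≡.cong (x ++ y) (lookup-++ʳ σ₁ σ₂ i)))
        (trans (drop-++ x y (k ↑ʳ i)) (sym (drop-++ (x ∘ (k ↑ʳ_)) (y ∘ (k ↑ʳ_)) i))))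

    eqs : Fin k → Def ((k ℕ.+ m) ℕ.+ (k ℕ.+ n))
    eqs i = var ((k ℕ.+ m) ↑ʳ (i ↑ˡ n)) ≈ᶠ var ((i ↑ˡ m) ↑ˡ (k ℕ.+ n))

module Grothendieck {c ℓ₁ ℓ₂} (G : OrderedAbelianGroup c ℓ₁ ℓ₂) where
  open Definability G

  private
    ℓ : Level
    ℓ = c ⊔ ℓ₁ ⊔ ℓ₂

  infix  8 -_
  infixl 7 _*_
  infixl 6 _+_
  infix  4 _≈_

  data K₀ : Set c where
    [_] : ∀ {n} → Def n → K₀
    0#  : K₀
    _+_ : K₀ → K₀ → K₀
    -_  : K₀ → K₀

  -- The least congruence satisfying the abelian group laws together with
  -- the two defining relations `bij` and `cut`.
  data _≈_ : K₀ → K₀ → Set ℓ where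
    bij       : ∀ {m n} {A : Def m} {B : Def n} → DefinableBijection A B → [ A ] ≈ [ B ]
    cut       : ∀ {n} (A B : Def n) → B ⊆ A → [ A ∖ B ] + [ B ] ≈ [ A ]

    refl      : ∀ {x} → x ≈ x
    sym       : ∀ {x y} → x ≈ y → y ≈ x
    trans     : ∀ {x y z} → x ≈ y → y ≈ z → x ≈ z
    +-cong    : ∀ {x y u v} → x ≈ y → u ≈ v → x + u ≈ y + v
    neg-cong  : ∀ {x y} → x ≈ y → - x ≈ - y
    +-assoc   : ∀ x y z → (x + y) + z ≈ x + (y + z)
    +-comm    : ∀ x y → x + y ≈ y + x
    +-idˡ     : ∀ x → 0# + x ≈ x
    +-invˡ    : ∀ x → - x + x ≈ 0#

  +-abelianGroup : AbelianGroup c ℓ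
  +-abelianGroup = record
    { Carrier = K₀ ; _≈_ = _≈_ ; _∙_ = _+_ ; ε = 0# ; _⁻¹ = -_
    ; isAbelianGroup = record
      { isGroup = record
        { isMonoid = record
          { isSemigroup = record
            { isMagma = record
              { isEquivalence = record { refl = refl ; sym = sym ; trans = trans }
              ; ∙-cong        = +-cong
              }
            ; assoc = +-assoc
            }
          ; identity = +-idˡ , λ x → trans (+-comm x 0#) (+-idˡ x)
          }
        ; inverse = +-invˡ , λ x → trans (+-comm x (- x)) (+-invˡ x)
        ; ⁻¹-cong = neg-cong
        }
      ; comm = +-comm
      }
    }

  -- The biadditive extension of [ A ] * [ B ] = [ A × B ].
  scale : ∀ {n} → Def n → K₀ → K₀
  scale A [ B ]   = [ A ⊗ B ]
  scale A 0#      = 0#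
  scale A (x + y) = scale A x + scale A y
  scale A (- x)   = - scale A x

  _*_ : K₀ → K₀ → K₀
  [ A ]   * z = scale A z
  0#      * z = 0#
  (x + y) * z = x * z + y * z
  (- x)   * z = - (x * z)

  1# : K₀
  1# = [ singleton (OrderedAbelianGroup.0# G) ]

  private
    open module AG = AbelianGroup +-abelianGroup using (setoid)
    open AbelianGroupProperties +-abelianGroup
      using (⁻¹-∙-comm; ε⁻¹≈ε; identityˡ-unique)
    open SetoidReasoning setoid

    interchange : ∀ w x y z → (w + x) + (y + z) ≈ (w + y) + (x + z)
    interchange w x y z = begin
      (w + x) + (y + z) ≈⟨ +-assoc w x (y + z) ⟩
      w + (x + (y + z)) ≈⟨ +-cong refl (+-assoc x y z) ⟨
      w + ((x + y) + z) ≈⟨ +-cong refl (+-cong (+-comm x y) refl) ⟩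
      w + ((y + x) + z) ≈⟨ +-cong refl (+-assoc y x z) ⟩
      w + (y + (x + z)) ≈⟨ +-assoc w y (x + z) ⟨
      (w + y) + (x + z) ∎

    0+0 : 0# + 0# ≈ 0#
    0+0 = +-idˡ 0#

    scale-cong : ∀ {n} (A : Def n) {x y} → x ≈ y → scale A x ≈ scale A y
    scale-cong A (bij f)         = bij (⊗-congʳ A f)
    scale-cong A (cut B C C⊆B)   = trans
      (+-cong (bij (same-extension (A ⊗ (B ∖ C)) ((A ⊗ B) ∖ (A ⊗ C))
                (λ _ (a , b , ¬c) → (a , b) , λ (_ , c) → ¬c c)
                (λ _ ((a , b) , ¬ac) → a , b , λ c → ¬ac (a , c))))
              refl)
      (cut (A ⊗ B) (A ⊗ C) (λ _ p → ⊗⁺ A B (⊗⁻ˡ A C p) (C⊆B _ (⊗⁻ʳ A C p))))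
    scale-cong A refl            = refl
    scale-cong A (sym p)         = sym (scale-cong A p)
    scale-cong A (trans p q)     = trans (scale-cong A p) (scale-cong A q)
    scale-cong A (+-cong p q)    = +-cong (scale-cong A p) (scale-cong A q)
    scale-cong A (neg-cong p)    = neg-cong (scale-cong A p)
    scale-cong A (+-assoc x y z) = +-assoc _ _ _
    scale-cong A (+-comm x y)    = +-comm _ _
    scale-cong A (+-idˡ x)       = +-idˡ _
    scale-cong A (+-invˡ x)      = +-invˡ _

    *-zeroʳ : ∀ x → x * 0# ≈ 0#
    *-zeroʳ [ A ]   = refl
    *-zeroʳ 0#      = refl
    *-zeroʳ (x + y) = trans (+-cong (*-zeroʳ x) (*-zeroʳ y)) 0+0
    *-zeroʳ (- x)   = trans (neg-cong (*-zeroʳ x)) ε⁻¹≈ε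

    *-distribˡ : ∀ x y z → x * (y + z) ≈ x * y + x * z
    *-distribˡ [ A ]   y z = refl
    *-distribˡ 0#      y z = sym 0+0
    *-distribˡ (w + x) y z =
      trans (+-cong (*-distribˡ w y z) (*-distribˡ x y z)) (interchange _ _ _ _)
    *-distribˡ (- x)   y z =
      trans (neg-cong (*-distribˡ x y z)) (sym (⁻¹-∙-comm (x * y) (x * z)))

    *-negʳ : ∀ x y → x * (- y) ≈ - (x * y)
    *-negʳ [ A ]   y = refl
    *-negʳ 0#      y = sym ε⁻¹≈ε
    *-negʳ (w + x) y = trans (+-cong (*-negʳ w y) (*-negʳ x y)) (⁻¹-∙-comm (w * y) (x * y))
    *-negʳ (- x)   y = neg-cong (*-negʳ x y)

    *-comm : ∀ x y → x * y ≈ y * x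
    *-comm [ A ] [ B ]   = bij (⊗-comm A B)
    *-comm [ A ] 0#      = refl
    *-comm [ A ] (x + y) = +-cong (*-comm [ A ] x) (*-comm [ A ] y)
    *-comm [ A ] (- x)   = neg-cong (*-comm [ A ] x)
    *-comm 0#      y     = sym (*-zeroʳ y)
    *-comm (w + x) y     = trans (+-cong (*-comm w y) (*-comm x y)) (sym (*-distribˡ y w x))
    *-comm (- x)   y     = trans (neg-cong (*-comm x y)) (sym (*-negʳ y x))

    *-congˡ : ∀ x {y z} → y ≈ z → x * y ≈ x * z
    *-congˡ [ A ]   p = scale-cong A p
    *-congˡ 0#      p = refl
    *-congˡ (w + x) p = +-cong (*-congˡ w p) (*-congˡ x p)
    *-congˡ (- x)   p = neg-cong (*-congˡ x p)

    *-cong : ∀ {x y u v} → x ≈ y → u ≈ v → x * u ≈ y * v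
    *-cong {x} {y} {u} {v} p q = begin
      x * u ≈⟨ *-congˡ x q ⟩
      x * v ≈⟨ *-comm x v ⟩
      v * x ≈⟨ *-congˡ v p ⟩
      v * y ≈⟨ *-comm v y ⟩
      y * v ∎

    *-assoc : ∀ x y z → (x * y) * z ≈ x * (y * z)
    *-assoc [ A ] [ B ] [ C ]   = bij (⊗-assoc A B C)
    *-assoc [ A ] [ B ] 0#      = refl
    *-assoc [ A ] [ B ] (x + y) = +-cong (*-assoc [ A ] [ B ] x) (*-assoc [ A ] [ B ] y)
    *-assoc [ A ] [ B ] (- x)   = neg-cong (*-assoc [ A ] [ B ] x)
    *-assoc [ A ] 0#      z     = refl
    *-assoc [ A ] (x + y) z     = +-cong (*-assoc [ A ] x z) (*-assoc [ A ] y z)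
    *-assoc [ A ] (- x)   z     = neg-cong (*-assoc [ A ] x z)
    *-assoc 0#      y z         = refl
    *-assoc (w + x) y z         = +-cong (*-assoc w y z) (*-assoc x y z)
    *-assoc (- x)   y z         = neg-cong (*-assoc x y z)

    *-identityˡ : ∀ x → 1# * x ≈ x
    *-identityˡ [ A ]   = bij (⊗-identityˡ _ A)
    *-identityˡ 0#      = refl
    *-identityˡ (x + y) = +-cong (*-identityˡ x) (*-identityˡ y)
    *-identityˡ (- x)   = neg-cong (*-identityˡ x)

  K : CommutativeRing c ℓ
  K = record
    { Carrier = K₀ ; _≈_ = _≈_ ; _+_ = _+_ ; _*_ = _*_ ; -_ = -_ ; 0# = 0# ; 1# = 1#
    ; isCommutativeRing = record
      { isRing = record
        { +-isAbelianGroup = AG.isAbelianGroup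
        ; *-cong           = *-cong
        ; *-assoc          = *-assoc
        ; *-identity       = *-identityˡ , λ x → trans (*-comm x 1#) (*-identityˡ x)
        ; distrib          = *-distribˡ , λ x y z → refl
        }
      ; *-comm = *-comm
      }
    }

  [∅]≈0 : ∀ {n} → [ ∅ {n} ] ≈ 0#
  [∅]≈0 {n} = identityˡ-unique [ ∅ ] [ ∅ ] (trans
    (+-cong (bij (same-extension ∅ (∅ {n} ∖ ∅) (λ _ ()) (λ _ → proj₁))) refl)
    (cut ∅ ∅ (λ _ p → p)))

  [singleton]≈1 : ∀ a → [ singleton a ] ≈ 1#
  [singleton]≈1 a = begin
    [ singleton a ]      ≈⟨ *-identityˡ [ singleton a ] ⟨
    1# * [ singleton a ] ≈⟨ *-comm 1# [ singleton a ] ⟩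
    [ singleton a ] * 1# ≈⟨ bij (⊗-identityˡ a (singleton _)) ⟩
    1#                   ∎

IsTrivial : ∀ {c ℓ} → CommutativeRing c ℓ → Set (c ⊔ ℓ)
IsTrivial R = ∀ x → x ≈ 0#
  where open CommutativeRing R

{-# OPTIONS --safe #-}
-- Let a ∉ nG, write d x for the class of the positive part of x + nG and g for
-- the class of nG.  Splitting pairs of positive elements by their order and
-- shearing (x , y) ↦ (x , y - x) gives relations between the products d x * d y
-- which say g² = 1 and that the g * d x are idempotents behaving like the truth
-- values of "x is positive" for a total order on the group G / nG.  Since a ≠ 0
-- is torsion there, no such order exists, so the ring is zero.
module Submission where

open import Defs
open import Algebra.Bundles using (AbelianGroup; CommutativeRing)
import Algebra.Definitions.RawMonoid as RawMonoidDefs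
import Algebra.Properties.AbelianGroup as AbelianGroupProperties
import Algebra.Properties.CommutativeMonoid.Mult as CommutativeMonoidMult
import Algebra.Properties.CommutativeSemigroup as CommutativeSemigroupProperties
import Algebra.Solver.Ring.NaturalCoefficients.Default as SemiringSolver
open import Axiom.ExcludedMiddle using (ExcludedMiddle)
open import Data.Empty using (⊥-elim)
open import Data.Fin.Base using (Fin; zero; suc; _↑ˡ_; _↑ʳ_)
open import Data.Nat.Base as ℕ using (ℕ; zero; suc; NonZero)
open import Data.Product.Base using (∃-syntax; _×_; _,_; proj₁)
open import Data.Sum.Base using (_⊎_; inj₁; inj₂)
open import Data.Vec.Functional using (Vector; []; _∷_)
open import Function.Base using (_∘_; id)
open import Function.Bundles using (mk⇔)
open import Level using (Level; _⊔_; Lift; lift; lower)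
open import Relation.Binary.Bundles using (Setoid)
open import Relation.Binary.Definitions using (Decidable; tri<; tri≈; tri>)
open import Relation.Binary.PropositionalEquality.Core as ≡ using (_≡_)
open import Relation.Binary.Structures using (IsStrictTotalOrder)
import Relation.Binary.Reasoning.Setoid as SetoidReasoning
open import Relation.Nullary using (¬_; yes; no)
open import Relation.Nullary.Decidable using (map′; decidable-stable)

-- Ring relations that collapse in the presence of torsion

module _ {q ℓq r ℓr} (Q : AbelianGroup q ℓq) (R : CommutativeRing r ℓr) where
  open CommutativeRing R
  private module Q = AbelianGroup Q

  module PositiveParts
    (_≟_ : Decidable Q._≈_)
    (d : Q.Carrier → Carrier) (d-cong : ∀ {x y} → x Q.≈ y → d x ≈ d y)
    (g : Carrier)
    (d-ε : d Q.ε + (1# + d Q.ε) ≈ g)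
    (d-inverse : ∀ {x} → ¬ x Q.≈ Q.ε → d x + d (x Q.⁻¹) ≈ g)
    (d-square : ∀ x → d x * d x ≈ d x * d Q.ε + (d x * d Q.ε + d x))
    (d-product : ∀ {x y} → ¬ x Q.≈ y → d x * d y ≈ d x * d (y Q.- x) + d y * d (x Q.- y))
    where

    open AbelianGroupProperties +-abelianGroup using (identityʳ-unique)
    open CommutativeSemigroupProperties *-commutativeSemigroup using (x∙yz≈y∙xz)
    private module QP = AbelianGroupProperties Q
    open RawMonoidDefs Q.rawMonoid using () renaming (_×_ to _·_)
    open SemiringSolver commutativeSemiring
    open SetoidReasoning setoid

    -- With `p = d Q.ε`, cancelling in `d-square` at `Q.ε` leaves `p * p + p ≈ 0#`. Since `g` is
    -- `1 + 2p`, its square is `1 + 4(p * p + p)`.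
    g*g : g * g ≈ 1#
    g*g = begin
      g * g                           ≈⟨ *-cong d-ε d-ε ⟨
      (p + (1# + p)) * (p + (1# + p)) ≈⟨ solve 2 (λ p u →
        (p :+ (u :+ p)) :* (p :+ (u :+ p)) := con 4 :* (p :* p :+ u :* p) :+ u :* u) refl p 1# ⟩
      -- The inferred factor is the image of the numeral 4.
      _ * (p * p + 1# * p) + 1# * 1#  ≈⟨ +-cong (*-congˡ p*p+1*p) (*-identityˡ 1#) ⟩
      _ * 0# + 1#                     ≈⟨ +-congʳ (zeroʳ _) ⟩
      0# + 1#                         ≈⟨ +-identityˡ 1# ⟩
      1#                              ∎
      where
      p = d Q.ε

      p*p+1*p : p * p + 1# * p ≈ 0#
      p*p+1*p = trans (+-congˡ (*-identityˡ p)) (identityʳ-unique (p * p) _ (sym (d-square Q.ε)))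

    -- The right-hand side of `d-square` is `d x` times `1 + 2p`. Together with `g*g` this makes
    -- `g * d x` idempotent.
    d*g : ∀ x → d x * d x ≈ d x * g
    d*g x = begin
      d x * d x                        ≈⟨ d-square x ⟩
      d x * p + (d x * p + d x)        ≈⟨ +-congˡ (+-congˡ (*-identityʳ (d x))) ⟨
      d x * p + (d x * p + d x * 1#)   ≈⟨ solve 3 (λ y p u →
        y :* p :+ (y :* p :+ y :* u) := y :* (p :+ (u :+ p))) refl (d x) p 1# ⟩
      d x * (p + (1# + p))             ≈⟨ *-congˡ d-ε ⟩
      d x * g                          ∎
      where p = d Q.ε

    *g-cancel : ∀ {x} → x * g ≈ 0# → x ≈ 0#
    *g-cancel {x} xg≈0 = begin
      x           ≈⟨ *-identityʳ x ⟨
      x * 1#      ≈⟨ *-congˡ g*g ⟨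
      x * (g * g) ≈⟨ *-assoc x g g ⟨
      x * g * g   ≈⟨ *-congʳ xg≈0 ⟩
      0# * g      ≈⟨ zeroˡ g ⟩
      0#          ∎

    -- Multiplying `d-inverse` by `d x` gives `d x * g`, which is already `d x * d x`, so the other
    -- summand vanishes. As truth values: `x` and its inverse are not both positive.
    d*d⁻¹ : ∀ {x} → ¬ x Q.≈ Q.ε → d x * d (x Q.⁻¹) ≈ 0#
    d*d⁻¹ {x} x≉ε = identityʳ-unique (d x * d x) _ (begin
      d x * d x + d x * d (x Q.⁻¹) ≈⟨ distribˡ _ _ _ ⟨
      d x * (d x + d (x Q.⁻¹))     ≈⟨ *-congˡ (d-inverse x≉ε) ⟩
      d x * g                      ≈⟨ d*g x ⟨
      d x * d x                    ∎)

    -- "If x and y are positive, then so is x ∙ y", for truth values d.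
    d-closed : ∀ {x y} → ¬ y Q.≈ Q.ε → ¬ x Q.∙ y Q.≈ Q.ε →
               d y * (d x * d ((x Q.∙ y) Q.⁻¹)) ≈ 0#
    d-closed {x} {y} y≉ε xy≉ε = begin
      d y * (d x * d ((x Q.∙ y) Q.⁻¹))       ≈⟨ *-congˡ (*-congˡ (d-cong
                                                  (QP.⁻¹-anti-homo-∙ x y))) ⟩
      -- The zero to be added is `d y * d y⁻¹ * z`. It completes the right-hand side of `d-product`
      -- for `x` and `y⁻¹`, whose left-hand side is killed by `d y` as well.
      d y * (d x * d (y⁻¹ Q.- x))            ≈⟨ +-identityʳ _ ⟨
      d y * (d x * d (y⁻¹ Q.- x)) + 0#       ≈⟨ +-congˡ (zeroˡ _) ⟨
      d y * (d x * d (y⁻¹ Q.- x)) + 0# * z   ≈⟨ +-congˡ (*-congʳ (d*d⁻¹ y≉ε)) ⟨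
      d y * (d x * d (y⁻¹ Q.- x)) + d y * d y⁻¹ * z
                                             ≈⟨ +-congˡ (*-assoc _ _ _) ⟩
      d y * (d x * d (y⁻¹ Q.- x)) + d y * (d y⁻¹ * z)
                                             ≈⟨ distribˡ _ _ _ ⟨
      d y * (d x * d (y⁻¹ Q.- x) + d y⁻¹ * z) ≈⟨ *-congˡ (d-product x≉y⁻¹) ⟨
      d y * (d x * d y⁻¹)                    ≈⟨ x∙yz≈y∙xz _ _ _ ⟩
      d x * (d y * d y⁻¹)                    ≈⟨ *-congˡ (d*d⁻¹ y≉ε) ⟩
      d x * 0#                               ≈⟨ zeroʳ _ ⟩
      0#                                     ∎
      where
      y⁻¹ = y Q.⁻¹
      z = d (x Q.- y⁻¹)

      x≉y⁻¹ : ¬ x Q.≈ y⁻¹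
      x≉y⁻¹ x≈y⁻¹ = xy≉ε (Q.trans (Q.∙-congʳ x≈y⁻¹) (Q.inverseˡ y))

    -- The truth-value form of "multiples of a positive element are positive", by induction on `k`.
    -- The alternative `d a ≈ 0#` takes over once some multiple is the identity.
    multiples : ∀ {a} → ¬ a Q.≈ Q.ε → ∀ k →
                d a ≈ 0# ⊎ (¬ suc k · a Q.≈ Q.ε × d a * d ((suc k · a) Q.⁻¹) ≈ 0#)
    multiples {a} a≉ε zero = inj₂
      ( (λ e → a≉ε (Q.trans (Q.sym (Q.identityʳ a)) e))
      , trans (*-congˡ (d-cong (Q.⁻¹-cong (Q.identityʳ a)))) (d*d⁻¹ a≉ε))
    multiples {a} a≉ε (suc k) with multiples a≉ε k
    ... | inj₁ da≈0 = inj₁ da≈0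
    ... | inj₂ (b≉ε , da*db⁻¹≈0) with (suc (suc k) · a) ≟ Q.ε
    -- Now `a` is the inverse of `suc k · a`, so the induction hypothesis says that `d a` squares to
    -- zero.
    ...   | yes ab≈ε = inj₁ (*g-cancel (begin
      d a * g              ≈⟨ d*g a ⟨
      d a * d a            ≈⟨ *-congˡ (d-cong (QP.inverseˡ-unique a (suc k · a) ab≈ε)) ⟩
      d a * d ((suc k · a) Q.⁻¹) ≈⟨ da*db⁻¹≈0 ⟩
      0#                   ∎))
    -- Multiplication by `g`, written as `d b + d (b Q.⁻¹)`, is a case split on the sign of `b`:
    -- `d-closed` settles the positive case, the induction hypothesis the negative one.
    ...   | no ab≉ε = inj₂ (ab≉ε , *g-cancel (begin
      d a * c * g                          ≈⟨ *-congˡ (d-inverse b≉ε) ⟨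
      d a * c * (d b + d (b Q.⁻¹))         ≈⟨ solve 4 (λ x y z w →
        x :* y :* (z :+ w) := z :* (x :* y) :+ x :* w :* y) refl (d a) c (d b) (d (b Q.⁻¹)) ⟩
      d b * (d a * c) + d a * d (b Q.⁻¹) * c ≈⟨ +-cong (d-closed b≉ε ab≉ε) (*-congʳ da*db⁻¹≈0) ⟩
      0# + 0# * c                          ≈⟨ trans (+-identityˡ _) (zeroˡ c) ⟩
      0#                                   ∎))
      where
      b = suc k · a
      c = d ((a Q.∙ b) Q.⁻¹)

    torsion⇒d≈0 : ∀ {a} n → ¬ a Q.≈ Q.ε → suc n · a Q.≈ Q.ε → d a ≈ 0#
    torsion⇒d≈0 n a≉ε na≈ε with multiples a≉ε n
    ... | inj₁ da≈0 = da≈0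
    ... | inj₂ (na≉ε , _) = ⊥-elim (na≉ε na≈ε)

    -- Both `a` and its inverse are torsion, so `d` vanishes at both. Their sum `g` is then zero as
    -- well as invertible.
    torsion⇒1≈0 : ∀ {a} n → ¬ a Q.≈ Q.ε → (∀ x → suc n · x Q.≈ Q.ε) → 1# ≈ 0#
    torsion⇒1≈0 {a} n a≉ε torsion = *g-cancel (begin
      1# * g           ≈⟨ *-identityˡ g ⟩
      g                ≈⟨ d-inverse a≉ε ⟨
      d a + d (a Q.⁻¹) ≈⟨ +-cong (torsion⇒d≈0 n a≉ε (torsion a))
                                 (torsion⇒d≈0 n a⁻¹≉ε (torsion (a Q.⁻¹))) ⟩
      0# + 0#          ≈⟨ +-identityˡ 0# ⟩
      0#               ∎)
      where
      a⁻¹≉ε : ¬ a Q.⁻¹ Q.≈ Q.ε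
      a⁻¹≉ε e = a≉ε (Q.trans (Q.sym (QP.⁻¹-involutive a)) (Q.trans (Q.⁻¹-cong e) QP.ε⁻¹≈ε))

module _ {c ℓ₁ ℓ₂} (G : OrderedAbelianGroup c ℓ₁ ℓ₂) where
  open OrderedAbelianGroup G
  open Definability G
  open Setoid setoid using (refl; sym; trans; reflexive)
  open AbelianGroup abelianGroup using (_-_; assoc; comm; identityˡ; identityʳ;
    inverseˡ; inverseʳ; ∙-cong; ∙-congˡ; ∙-congʳ; ⁻¹-cong; commutativeMonoid)
  open IsStrictTotalOrder isStrictTotalOrder using (compare; irrefl; <-respˡ-≈; <-respʳ-≈)
    renaming (trans to <-trans)
  open AbelianGroupProperties abelianGroup
    using (//-rightDividesˡ; //-rightDividesʳ; ⁻¹-involutive; ⁻¹-∙-comm;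
      inverseˡ-unique; inverseʳ-unique; xyx⁻¹≈y)
  open RawMonoidDefs rawMonoid using () renaming (_×_ to _·_)
  open CommutativeMonoidMult commutativeMonoid using (×-congʳ; ×-distrib-+)

  private
    ℓ : Level
    ℓ = c ⊔ ℓ₁ ⊔ ℓ₂

  -- Order arithmetic and bijections given by terms

  x+[y-x]≈y : ∀ x y → x + (y - x) ≈ y
  x+[y-x]≈y x y = trans (comm x (y - x)) (//-rightDividesˡ x y)

  x<y⇒0<y-x : ∀ {x y} → x < y → 0# < y - x
  x<y⇒0<y-x {x} x<y = <-respˡ-≈ (inverseʳ x) (+-monoˡ-< (- x) x<y)

  0<y⇒x<x+y : ∀ x {y} → 0# < y → x < x + y
  0<y⇒x<x+y x {y} 0<y = <-respˡ-≈ (identityˡ x) (<-respʳ-≈ (comm y x) (+-monoˡ-< x 0<y))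

  x<0⇒0<-x : ∀ {x} → x < 0# → 0# < - x
  x<0⇒0<-x {x} x<0 = <-respʳ-≈ (identityˡ (- x)) (x<y⇒0<y-x x<0)

  0<x⇒-x<0 : ∀ {x} → 0# < x → - x < 0#
  0<x⇒-x<0 {x} 0<x = <-respʳ-≈ (inverseʳ x) (<-respˡ-≈ (identityˡ (- x)) (+-monoˡ-< (- x) 0<x))

  eval-cong : ∀ {k} (t : Term Carrier k) {v w} → v ≋ w → eval t v ≈ eval t w
  eval-cong t {v} p = trans (sym (eval-rename t id {v} (λ _ → refl))) (eval-rename t id p)

  -- For maps given by terms definability is automatic: the graph is `A` together with one equation
  -- for each output coordinate.
  term-bijection : ∀ {k l} (A : Def k) (B : Def l)
    (to : Vector (Term Carrier k) l) (from : Vector (Term Carrier l) k) →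
    (∀ x → Sat A x → Sat B (λ j → eval (to j) x)) →
    (∀ y → Sat B y → Sat A (λ i → eval (from i) y)) →
    (∀ x → Sat A x → ∀ i → eval (from i) (λ j → eval (to j) x) ≈ x i) →
    (∀ y → Sat B y → ∀ j → eval (to j) (λ i → eval (from i) y) ≈ y j) →
    DefinableBijection A B
  term-bijection {k} {l} A B to from to-sat from-sat from∘to to∘from = record
    { bijection = record
      { to        = λ (x , p) → (λ j → eval (to j) x) , to-sat x p
      ; cong      = λ e j → eval-cong (to j) e
      ; bijective =
          (λ {(x , p)} {(y , q)} e i → trans (sym (from∘to x p i))
             (trans (eval-cong (from i) e) (from∘to y q i)))
        , (λ (y , q) → ((λ i → eval (from i) y) , from-sat y q) ,
             λ e j → trans (eval-cong (to j) e) (to∘from y q j))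
      }
    ; graph     = rename (_↑ˡ l) A ∧ᶠ ⋀ᶠ eqs
    ; graph-def = λ x y → mk⇔
        (λ (p , q) → rename⁻ A _ (take-++ x y) p , λ j →
           trans (sym (eval-rename (to j) (_↑ˡ l) (take-++ x y)))
                 (trans (sym (lower (⋀⁻ eqs q j))) (drop-++ x y j)))
        (λ (p , q) → rename⁺ A _ (take-++ x y) p , ⋀⁺ eqs (λ j → lift
           (trans (drop-++ x y j)
                  (trans (sym (q j)) (sym (eval-rename (to j) (_↑ˡ l) (take-++ x y)))))))
    }
    where
    eqs : Fin l → Def (k ℕ.+ l)
    eqs j = var (k ↑ʳ j) ≈ᶠ renameᵗ (_↑ˡ l) (to j)

  module _ (n : ℕ) where

    -- The quotient of G by nG

    infix 4 _~_
    -- Congruence modulo nG, in the shape in which the formula `coset` is satisfied.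
    _~_ : Carrier → Carrier → Set (c ⊔ ℓ₁)
    x ~ y = ∃[ h ] n · h + x ≈ y

    n·0≈0 : n · 0# ≈ 0#
    n·0≈0 = trans (sym (//-rightDividesʳ (n · 0#) (n · 0#)))
      (trans (∙-congʳ (trans (sym (×-distrib-+ 0# 0# n)) (×-congʳ n (identityˡ 0#))))
             (inverseʳ (n · 0#)))

    n·-x≈-[n·x] : ∀ x → n · - x ≈ - (n · x)
    n·-x≈-[n·x] x = inverseˡ-unique _ _
      (trans (sym (×-distrib-+ (- x) x n)) (trans (×-congʳ n (inverseˡ x)) n·0≈0))

    ≈⇒~ : ∀ {x y} → x ≈ y → x ~ y
    ≈⇒~ {x} x≈y = 0# , trans (∙-congʳ n·0≈0) (trans (identityˡ x) x≈y)

    ~-trans : ∀ {x y z} → x ~ y → y ~ z → x ~ z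
    ~-trans {x} (h , p) (k , q) = k + h ,
      trans (∙-congʳ (×-distrib-+ k h n)) (trans (assoc _ _ x) (trans (∙-congˡ p) q))

    ~-sym : ∀ {x y} → x ~ y → y ~ x
    ~-sym {x} {y} (h , p) = - h , (begin
      n · - h + y              ≈⟨ ∙-cong (n·-x≈-[n·x] h) (sym p) ⟩
      - (n · h) + (n · h + x)  ≈⟨ assoc _ _ x ⟨
      - (n · h) + n · h + x    ≈⟨ ∙-congʳ (inverseˡ (n · h)) ⟩
      0# + x                   ≈⟨ identityˡ x ⟩
      x                        ∎)
      where open SetoidReasoning setoid

    +-cong-~ : ∀ {x y u v} → x ~ y → u ~ v → x + u ~ y + v
    +-cong-~ {x} {y} {u} {v} (h , p) (k , q) = h + k , (begin
      n · (h + k) + (x + u)     ≈⟨ ∙-congʳ (×-distrib-+ h k n) ⟩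
      n · h + n · k + (x + u)   ≈⟨ interchange (n · h) (n · k) x u ⟩
      n · h + x + (n · k + u)   ≈⟨ ∙-cong p q ⟩
      y + v                     ∎)
      where
      open SetoidReasoning setoid
      open CommutativeSemigroupProperties
        (AbelianGroup.commutativeSemigroup abelianGroup) using (interchange)

    neg-cong-~ : ∀ {x y} → x ~ y → - x ~ - y
    neg-cong-~ {x} {y} (h , p) = - h ,
      trans (∙-congʳ (n·-x≈-[n·x] h)) (trans (⁻¹-∙-comm (n · h) x) (⁻¹-cong p))

    G/nG : AbelianGroup c (c ⊔ ℓ₁)
    G/nG = record
      { Carrier = Carrier ; _≈_ = _~_ ; _∙_ = _+_ ; ε = 0# ; _⁻¹ = -_
      ; isAbelianGroup = record
        { isGroup = record
          { isMonoid = record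
            { isSemigroup = record
              { isMagma = record
                { isEquivalence = record { refl = ≈⇒~ refl ; sym = ~-sym ; trans = ~-trans }
                ; ∙-cong        = +-cong-~
                }
              ; assoc = λ x y z → ≈⇒~ (assoc x y z)
              }
            ; identity = (λ x → ≈⇒~ (identityˡ x)) , (λ x → ≈⇒~ (identityʳ x))
            }
          ; inverse = (λ x → ≈⇒~ (inverseˡ x)) , (λ x → ≈⇒~ (inverseʳ x))
          ; ⁻¹-cong = neg-cong-~
          }
        ; comm = λ x y → ≈⇒~ (comm x y)
        }
      }

    open RawMonoidDefs (AbelianGroup.rawMonoid G/nG) using () renaming (_×_ to _·′_)

    -- The two multiples agree only propositionally: the raw monoids carry different equalities.
    ·′≡· : ∀ m x → m ·′ x ≡ m · x
    ·′≡· zero    x = ≡.refl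
    ·′≡· (suc m) x = ≡.cong (x +_) (·′≡· m x)

    -- This is the torsion that rules out a total order on the quotient.
    n·′x~0 : ∀ x → n ·′ x ~ 0#
    n·′x~0 x = - x , trans (∙-cong (n·-x≈-[n·x] x) (reflexive (·′≡· n x))) (inverseˡ (n · x))

    -- Cosets, their signed parts and pairs as definable sets

    _·ᵗ_ : ∀ {k} → ℕ → Term Carrier k → Term Carrier k
    zero  ·ᵗ t = 0ᵗ
    suc m ·ᵗ t = t +ᵗ m ·ᵗ t

    eval-·ᵗ : ∀ {k} m (t : Term Carrier k) v → eval (m ·ᵗ t) v ≈ m · eval t v
    eval-·ᵗ zero    t v = refl
    eval-·ᵗ (suc m) t v = ∙-congˡ (eval-·ᵗ m t v)

    coset : Carrier → Def 1
    coset a = ∃ᶠ (n ·ᵗ var zero +ᵗ par a ≈ᶠ var (suc zero))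

    coset⁺ : ∀ {a} v → a ~ v zero → Sat (coset a) v
    coset⁺ v (h , p) = h , lift (trans (∙-congʳ (eval-·ᵗ n (var zero) (h ∷ v))) p)

    coset⁻ : ∀ {a} v → Sat (coset a) v → a ~ v zero
    coset⁻ v (h , lift p) = h , trans (∙-congʳ (sym (eval-·ᵗ n (var zero) (h ∷ v)))) p

    pos neg : Carrier → Def 1
    pos a = coset a ∧ᶠ 0ᵗ <ᶠ var zero
    neg a = coset a ∧ᶠ var zero <ᶠ 0ᵗ

    pos⁺ : ∀ {a} v → 0# < v zero → a ~ v zero → Sat (pos a) v
    pos⁺ v p q = coset⁺ v q , lift p

    pos⁻ : ∀ {a} v → Sat (pos a) v → 0# < v zero × a ~ v zero
    pos⁻ v (q , lift p) = p , coset⁻ v q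

    below above diagonal : Carrier → Carrier → Def 2
    below    a b = pos a ⊗ pos b ∧ᶠ var zero <ᶠ var (suc zero)
    above    a b = pos a ⊗ pos b ∧ᶠ var (suc zero) <ᶠ var zero
    diagonal a b = pos a ⊗ pos b ∧ᶠ var zero ≈ᶠ var (suc zero)

    pair⁺ : ∀ {a b} v → 0# < v zero → a ~ v zero → 0# < v (suc zero) → b ~ v (suc zero) →
            Sat (pos a ⊗ pos b) v
    pair⁺ {a} {b} v p q r s = ⊗⁺ (pos a) (pos b) (pos⁺ _ p q) (pos⁺ _ r s)

    pair⁻ : ∀ {a b} v → Sat (pos a ⊗ pos b) v →
            (0# < v zero × a ~ v zero) × (0# < v (suc zero) × b ~ v (suc zero))
    pair⁻ {a} {b} v p = pos⁻ _ (⊗⁻ˡ (pos a) (pos b) p) , pos⁻ _ (⊗⁻ʳ (pos a) (pos b) p)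

    -- Definable bijections between these sets

    translation : ∀ a → DefinableBijection (coset a) (coset 0#)
    translation a = term-bijection (coset a) (coset 0#)
      (λ _ → var zero +ᵗ -ᵗ par a) (λ _ → var zero +ᵗ par a)
      (λ x p → coset⁺ _ (~-trans (≈⇒~ (sym (inverseʳ a)))
                           (+-cong-~ (coset⁻ x p) (≈⇒~ refl))))
      (λ y q → coset⁺ _ (~-trans (≈⇒~ (sym (identityˡ a)))
                           (+-cong-~ (coset⁻ y q) (≈⇒~ refl))))
      (λ { x p zero → //-rightDividesˡ a (x zero) })
      (λ { y q zero → //-rightDividesʳ a (y zero) })

    reflection : ∀ a → DefinableBijection (pos (- a)) (neg a)
    reflection a = term-bijection (pos (- a)) (neg a) (λ _ → -ᵗ var zero) (λ _ → -ᵗ var zero)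
      (λ x p → let (0<x , -a~x) = pos⁻ x p in
         coset⁺ _ (~-trans (≈⇒~ (sym (⁻¹-involutive a))) (neg-cong-~ -a~x)) ,
         lift (0<x⇒-x<0 0<x))
      (λ { y (q , lift y<0) → pos⁺ _ (x<0⇒0<-x y<0) (neg-cong-~ (coset⁻ y q)) })
      (λ { x p zero → ⁻¹-involutive (x zero) })
      (λ { y q zero → ⁻¹-involutive (y zero) })

    -- The map `(x , y) ↦ (x , x + y)` turns positivity of `y` into `x < x + y`. The coset of
    -- `b - a` is the one that `x` in the coset of `a` shifts to the coset of `b`.
    shear : ∀ a b → DefinableBijection (pos a ⊗ pos (b - a)) (below a b)
    shear a b = term-bijection (pos a ⊗ pos (b - a)) (below a b)
      (var zero ∷ var zero +ᵗ var (suc zero) ∷ [])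
      (var zero ∷ var (suc zero) +ᵗ -ᵗ var zero ∷ [])
      (λ x p → let ((0<x₀ , a~x₀) , (0<x₁ , b-a~x₁)) = pair⁻ x p
                   x₀<x₀+x₁ = 0<y⇒x<x+y (x zero) 0<x₁ in
         pair⁺ _ 0<x₀ a~x₀ (<-trans 0<x₀ x₀<x₀+x₁)
           (~-trans (≈⇒~ (sym (x+[y-x]≈y a b))) (+-cong-~ a~x₀ b-a~x₁))
         , lift x₀<x₀+x₁)
      (λ { y (p , lift y₀<y₁) → let ((0<y₀ , a~y₀) , (0<y₁ , b~y₁)) = pair⁻ y p in
         pair⁺ _ 0<y₀ a~y₀ (x<y⇒0<y-x y₀<y₁) (+-cong-~ b~y₁ (neg-cong-~ a~y₀)) })
      (λ { x p zero → refl ; x p (suc zero) → xyx⁻¹≈y (x zero) (x (suc zero)) })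
      (λ { y q zero → refl ; y q (suc zero) → x+[y-x]≈y (y zero) (y (suc zero)) })

    -- Reduces the half with the larger first coordinate to a set already covered by `shear`.
    swapping : ∀ a b → DefinableBijection (below b a) (above a b)
    swapping a b = reindexing (below b a) (above a b) (suc zero ∷ zero ∷ [])
      (λ { x (p , q) → let ((r , s) , (t , u)) = pair⁻ x p in pair⁺ _ t u r s , q })
      (λ { x y _ _ e zero → e (suc zero) ; x y _ _ e (suc zero) → e zero })
      (λ { y (p , q) → let ((r , s) , (t , u)) = pair⁻ y p in
         y ∘ (suc zero ∷ zero ∷ []) , (pair⁺ _ t u r s , q) ,
         λ { zero → refl ; (suc zero) → refl } })

    projection : ∀ a → DefinableBijection (diagonal a a) (pos a)
    projection a = term-bijection (diagonal a a) (pos a)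
      (λ _ → var zero) (λ _ → var zero)
      (λ x (p , _) → let ((r , s) , _) = pair⁻ x p in pos⁺ _ r s)
      (λ y p → let (r , s) = pos⁻ y p in pair⁺ _ r s r s , lift refl)
      (λ { x p zero → refl ; x (_ , lift e) (suc zero) → e })
      (λ { y q zero → refl })

    -- Additivity of classes

    open Grothendieck G using (K; [_]; bij; cut; [∅]≈0)
    private
      module K = CommutativeRing K
      module K-Reasoning = SetoidReasoning K.setoid

    -- Since `A` and `B` are disjoint and cover `C`, the set `A` has the same extension as `C ∖ B`,
    -- to which `cut` applies.
    [∪] : ∀ {k} (A B C : Def k) → A ⊆ C → B ⊆ C →
          (∀ x → Sat C x → Sat A x ⊎ Sat B x) → (∀ x → Sat A x → ¬ Sat B x) →
          [ C ] K.≈ [ A ] K.+ [ B ]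
    [∪] A B C A⊆C B⊆C cover disjoint = K.sym (K.trans
      (K.+-congʳ (bij (same-extension A (C ∖ B)
        (λ x a → A⊆C x a , λ b → ⊥-elim (disjoint x a b))
        (λ x (p , ¬b) → left x (cover x p) ¬b))))
      (cut C B B⊆C))
      where
      left : ∀ x → Sat A x ⊎ Sat B x → Sat (¬ᶠ B) x → Sat A x
      left x (inj₁ a) ¬b = a
      left x (inj₂ b) ¬b with () ← ¬b b

    -- The terms are arbitrary because two instances are wanted: zero against a coordinate, and one
    -- coordinate against the other.
    [trichotomy] : ∀ {k} (A : Def k) (s t : Term Carrier k) →
      [ A ] K.≈ [ A ∧ᶠ s <ᶠ t ] K.+ ([ A ∧ᶠ t <ᶠ s ] K.+ [ A ∧ᶠ s ≈ᶠ t ])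
    [trichotomy] A s t = K.trans
      ([∪] (A ∧ᶠ s <ᶠ t) (A ∧ᶠ (t <ᶠ s ∨ᶠ s ≈ᶠ t)) A (λ _ → proj₁) (λ _ → proj₁) cover
        (λ { _ (_ , lift p) (_ , inj₁ (lift q)) → irrefl refl (<-trans p q)
           ; _ (_ , lift p) (_ , inj₂ (lift q)) → irrefl q p }))
      (K.+-congˡ ([∪] (A ∧ᶠ t <ᶠ s) (A ∧ᶠ s ≈ᶠ t) (A ∧ᶠ (t <ᶠ s ∨ᶠ s ≈ᶠ t))
        (λ { _ (a , p) → a , inj₁ p }) (λ { _ (a , p) → a , inj₂ p })
        (λ { _ (a , inj₁ p) → inj₁ (a , p) ; _ (a , inj₂ p) → inj₂ (a , p) })
        (λ { _ (_ , lift p) (_ , lift q) → irrefl (sym q) p })))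
      where
      cover : ∀ x → Sat A x → Sat (A ∧ᶠ s <ᶠ t) x ⊎ Sat (A ∧ᶠ (t <ᶠ s ∨ᶠ s ≈ᶠ t)) x
      cover x a with compare (eval s x) (eval t x)
      ... | tri< p _ _ = inj₁ (a , lift p)
      ... | tri≈ _ p _ = inj₂ (a , inj₂ (lift p))
      ... | tri> _ _ p = inj₂ (a , inj₁ (lift p))

    [empty] : ∀ {k} (A : Def k) → (∀ x → ¬ Sat A x) → [ A ] K.≈ K.0#
    [empty] A empty = K.trans
      (bij (same-extension A ∅ (λ x p → ⊥-elim (empty x p)) (λ _ ()))) [∅]≈0

    -- The relations between the classes of positive parts

    d : Carrier → K.Carrier
    d a = [ pos a ]

    d-cong : ∀ {a b} → a ~ b → d a K.≈ d b
    d-cong {a} {b} a~b = bij (same-extension (pos a) (pos b)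
      (λ x p → let (r , s) = pos⁻ x p in pos⁺ _ r (~-trans (~-sym a~b) s))
      (λ x p → let (r , s) = pos⁻ x p in pos⁺ _ r (~-trans a~b s)))

    -- Reflection replaces the negative part by `d (- a)`. The zero part stays unevaluated: it is a
    -- point or empty according to whether `a` lies in nG.
    d-trichotomy : ∀ a → [ coset a ] K.≈ d a K.+ (d (- a) K.+ [ coset a ∧ᶠ 0ᵗ ≈ᶠ var zero ])
    d-trichotomy a = K.trans ([trichotomy] (coset a) 0ᵗ (var zero))
      (K.+-congˡ (K.+-congʳ (K.sym (bij (reflection a)))))

    d-0 : d 0# K.+ (K.1# K.+ d 0#) K.≈ [ coset 0# ]
    d-0 = begin
      d 0# K.+ (K.1# K.+ d 0#) ≈⟨ K.+-congˡ (K.+-comm _ _) ⟩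
      d 0# K.+ (d 0# K.+ K.1#) ≈⟨ K.+-congˡ (K.+-cong (d-cong (≈⇒~ (sym -0≈0))) origin) ⟩
      d 0# K.+ (d (- 0#) K.+ _) ≈⟨ d-trichotomy 0# ⟨
      [ coset 0# ]             ∎
      where
      open K-Reasoning
      -0≈0 : - 0# ≈ 0#
      -0≈0 = AbelianGroupProperties.ε⁻¹≈ε abelianGroup

      origin : K.1# K.≈ [ coset 0# ∧ᶠ 0ᵗ ≈ᶠ var zero ]
      origin = bij (same-extension (singleton 0#) (coset 0# ∧ᶠ 0ᵗ ≈ᶠ var zero)
        (λ { x (lift p) → coset⁺ x (≈⇒~ (sym p)) , lift (sym p) })
        (λ { x (_ , lift p) → lift (sym p) }))

    -- A coset other than nG misses zero, so only its two signs remain; by translation its class is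
    -- that of nG.
    d-neg : ∀ {a} → ¬ a ~ 0# → d a K.+ d (- a) K.≈ [ coset 0# ]
    d-neg {a} a≁0 = begin
      d a K.+ d (- a)               ≈⟨ K.+-congˡ (K.+-identityʳ _) ⟨
      d a K.+ (d (- a) K.+ K.0#)    ≈⟨ K.+-congˡ (K.+-congˡ no-origin) ⟨
      d a K.+ (d (- a) K.+ _)       ≈⟨ d-trichotomy a ⟨
      [ coset a ]                   ≈⟨ bij (translation a) ⟩
      [ coset 0# ]                  ∎
      where
      open K-Reasoning
      no-origin : [ coset a ∧ᶠ 0ᵗ ≈ᶠ var zero ] K.≈ K.0#
      no-origin = [empty] _ (λ { x (p , lift q) → a≁0 (~-trans (coset⁻ x p) (≈⇒~ (sym q))) })

    -- The two strict halves are sheared products, `above` after exchanging the coordinates. The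
    -- diagonal is left for the next two lemmas: a copy of `pos a` when the cosets agree, empty when
    -- they differ.
    d-*-trichotomy : ∀ a b →
      d a K.* d b K.≈ d a K.* d (b - a) K.+ (d b K.* d (a - b) K.+ [ diagonal a b ])
    d-*-trichotomy a b = K.trans ([trichotomy] (pos a ⊗ pos b) (var zero) (var (suc zero)))
      (K.+-cong (K.sym (bij (shear a b)))
        (K.+-congʳ (K.sym (K.trans (bij (shear b a)) (bij (swapping a b))))))

    d-square : ∀ a → d a K.* d a K.≈ d a K.* d 0# K.+ (d a K.* d 0# K.+ d a)
    d-square a = K.trans (d-*-trichotomy a a)
      (K.+-cong a-a (K.+-cong a-a (bij (projection a))))
      where
      a-a : d a K.* d (a - a) K.≈ d a K.* d 0#
      a-a = K.*-congˡ (d-cong (≈⇒~ (inverseʳ a)))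

    d-product : ∀ {a b} → ¬ a ~ b → d a K.* d b K.≈ d a K.* d (b - a) K.+ d b K.* d (a - b)
    d-product {a} {b} a≁b = K.trans (d-*-trichotomy a b)
      (K.+-congˡ (K.trans (K.+-congˡ no-diagonal) (K.+-identityʳ _)))
      where
      no-diagonal : [ diagonal a b ] K.≈ K.0#
      no-diagonal = [empty] _ (λ { x (p , lift e) → let ((_ , a~x₀) , (_ , b~x₁)) = pair⁻ x p in
        a≁b (~-trans a~x₀ (~-trans (≈⇒~ e) (~-sym b~x₁))) })

  -- From failure of divisibility to triviality

  open Grothendieck G using (K; [_])
  private module K = CommutativeRing K

  ¬-Divisible⇒1≈0 : ExcludedMiddle ℓ → ∀ n .{{_ : NonZero n}} {a} →
                    ¬ (∃[ h ] n · h ≈ a) → K.1# K.≈ K.0#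
  ¬-Divisible⇒1≈0 em (suc n) {a} a∉nG = torsion⇒1≈0 n
    -- If `a` were zero in the quotient, say `suc n · h + a ≈ 0#`, then `- h` would divide `a` by
    -- `suc n`.
    (λ (h , p) → a∉nG (- h , trans (n·-x≈-[n·x] (suc n) h) (sym (inverseʳ-unique _ _ p))))
    (n·′x~0 (suc n))
    where
    -- Excluded middle decides whether a multiple is zero in the quotient, as the induction in
    -- `multiples` requires.
    _≟_ : Decidable (_~_ (suc n))
    x ≟ y = map′ lower lift (em {Lift ℓ (_~_ (suc n) x y)})

    open PositiveParts (G/nG (suc n)) K _≟_ (d (suc n)) (d-cong (suc n))
      [ coset (suc n) 0# ] (d-0 (suc n)) (d-neg (suc n))
      (d-square (suc n)) (d-product (suc n))

theorem1 : ∀ {c ℓ₁ ℓ₂} → ExcludedMiddle (c ⊔ ℓ₁ ⊔ ℓ₂) → (G : OrderedAbelianGroup c ℓ₁ ℓ₂) → ¬ Divisible G → IsTrivial (Grothendieck.K G)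
theorem1 {c} {ℓ₁} {ℓ₂} em G ¬divisible x = begin
  x      ≈⟨ *-identityˡ x ⟨
  1# * x ≈⟨ *-congʳ 1≈0 ⟩
  0# * x ≈⟨ zeroˡ x ⟩
  0#     ∎
  where
  open CommutativeRing (Grothendieck.K G)
  open SetoidReasoning setoid

  1≈0 : 1# ≈ 0#
  -- `¬divisible` hands over no element outside nG. So the argument is by contradiction: if `1#`
  -- were not zero, no element could lie outside any nG with `n` nonzero, and G would be divisible.
  1≈0 with em {1# ≈ 0#}
  ... | yes 1≈0 = 1≈0
  ... | no 1≉0  = ⊥-elim (¬divisible λ n a → decidable-stable
    (map′ lower lift (em {Lift (c ⊔ ℓ₁ ⊔ ℓ₂) _})) λ a∉nG → 1≉0 (¬-Divisible⇒1≈0 G em n a∉nG))
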